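{- Let $L$ be a metric signature. Every (continuous) Palyutin formula $\varphi(x)$ in $L$ is bipreserved under reduced products; that is, for every family $M=(M_i)_{i\in I}$ of $L$-structures, every filter $F$ on $I$ and every tuple $a\in\prod_i M_i^x$, \[\varphi^{M_F}(a_F)=\limsup_{i\to F}\varphi^{M_i}(a_i).\]
   Context: Continuous first-order logic. The domains of (metric) $L$-structures are nonempty complete bounded metric spaces; predicates are bounded uniformly continuous real-valued maps, with bounds and moduli of uniform continuity prescribed by the signature. Formulas are built from atomic formulas (predicates, including the metric $d$, applied to terms) using continuous connectives $\mathbb R^n\to\mathbb R$ and the quantifiers $\sup,\inf$; formulas are $\mathbb R$-valued. A unary connective is a continuous map $\mathbb R\to\mathbb R$. All filters are proper filters on nonempty sets. For a bounded family of reals, $\limsup_{i\to F}u_i=\inf_{J\in F}\sup_{i\in J}u_i$. Reduced products: on $\prod_i M_i$ let $d_F(a,b)=\limsup_{i\to F}d^{M_i}(a_i,b_i)$. The reduced product $M_F=\prod_i M_i/F$ has as domain the quotient of $\prod_iM_i$ by $d_F(a,b)=0$ (a complete bounded metric space); $a_F$ denotes the image of $a$; constants and functions are interpreted coordinatewise, and $p^{M_F}(a_F)=\limsup_{i\to F}p^{M_i}(a_i)$ for predicate symbols $p$. A formula $\varphi(x)$ is preserved under reduced products if always $\varphi^{M_F}(a_F)\le\limsup_{i\to F}\varphi^{M_i}(a_i)$, copreserved if always $\limsup_{i\to F}\varphi^{M_i}(a_i)\le\varphi^{M_F}(a_F)$, and bipreserved if both. Palyutin formulas: the smallest set of formulas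 such that (1) every atomic formula is Palyutin; (2) if $\varphi$ is Palyutin and $C$ is a nondecreasing unary connective, then $C\varphi$ is Palyutin; (3) if $\varphi,\psi$ are Palyutin, so is $\max(\varphi,\psi)$; (4) if $\varphi$ is Palyutin and $x$ is a variable, $\inf_x\varphi$ and $\sup_x\varphi$ are Palyutin; (5) if $\varphi,\psi$ are Palyutin, $D$ is a nonincreasing unary connective with (necessarily unique) fixed point $\Delta$, and $x$ is a variable, then $\max(\inf_x\varphi,\ \sup_x\min(D\varphi,\Delta,\psi))$ is Palyutin. -}

module Defs where

open import Algebra.Bundles using (AbelianGroup)
import Algebra.Properties.AbelianGroup as AbelianGroupProperties
import Algebra.Properties.CommutativeSemigroup as CommutativeSemigroupProperties
open import Axiom.ExcludedMiddle using (ExcludedMiddle)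
open import Data.Bool.Base using (if_then_else_)
open import Data.Empty using (⊥-elim)
open import Data.Fin.Base using (Fin)
open import Data.Integer.Base as ℤ using (+_; -[1+_])
import Data.Integer.Properties as ℤ
open import Data.Nat.Base as ℕ using (ℕ; zero; suc)
import Data.Nat.Properties as ℕ
open import Data.Product using (∃; _×_; _,_; proj₁; proj₂; map₂; swap; uncurry)
open import Data.Rational.Base as ℚ using (ℚ; 0ℚ; 1ℚ; ½; mkℚ)
import Data.Rational.Properties as ℚ
open import Data.Rational.Solver using (module +-*-Solver)
import Data.Rational.Unnormalised.Base as ℚᵘ
import Data.Rational.Unnormalised.Properties as ℚᵘ
open import Data.Sum using (_⊎_; inj₁; inj₂; [_,_])
open import Data.Vec.Base as Vec using (Vec; []; _∷_)
open import Data.Vec.Relation.Binary.Pointwise.Inductive using (Pointwise; []; _∷_)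
open import Function using (_∘_; id)
open import Function.Metric.Structures using (IsGeneralMetric)
open import Level using (Level; 0ℓ; Lift; lift) renaming (suc to lsuc)
open import Relation.Binary.Bundles using (Poset)
open import Relation.Binary.Core using (Rel)
open import Relation.Binary.Definitions using (tri<; tri≈; tri>)
import Relation.Binary.Reasoning.PartialOrder as PosetReasoning
open import Relation.Binary.Structures using (IsEquivalence; IsPartialOrder)
open import Relation.Binary.PropositionalEquality as ≡ using (_≡_; refl; cong; subst)
open import Relation.Nullary using (¬_; Dec; yes; no; does)
open import Relation.Nullary.Decidable using (True; toWitness; fromWitness; decidable-stable)
open import Relation.Unary using (Pred; _∈_; _∉_; _⊆_; _∩_)
open import Relation.Unary.Polymorphic using (U; ∅)

-- Dedekind cuts, represented by their lower halves; the equality of reals is _≈_.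
record ℝ : Set₁ where
  no-eta-equality
  field
    lower     : Pred ℚ 0ℓ
    inhabited : ∃ lower
    proper    : ∃ λ q → ¬ lower q
    closed    : ∀ {p q} → p ℚ.< q → lower q → lower p
    rounded   : ∀ {p} → lower p → ∃ λ q → p ℚ.< q × lower q
open ℝ public

infix 4 _≤_ _<_ _≈_

record _≤_ (x y : ℝ) : Set where
  constructor mk≤
  field ≤⇒⊆ : lower x ⊆ lower y
open _≤_ public

-- Some rational q satisfies x ≤ q < y.
record _<_ (x y : ℝ) : Set where
  constructor mk<
  field
    {between} : ℚ
    below     : lower y between
    above     : ¬ lower x between

_≈_ : ℝ → ℝ → Set
x ≈ y = x ≤ y × y ≤ x

private
  q-1<q : ∀ q → q ℚ.- 1ℚ ℚ.< q
  q-1<q q = subst (q ℚ.- 1ℚ ℚ.<_) (ℚ.+-identityʳ q) (ℚ.+-monoʳ-< q (ℚ.negative⁻¹ (ℚ.- 1ℚ)))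

  p+s-p : ∀ p s → s ≡ p ℚ.+ (s ℚ.- p)
  p+s-p = solve 2 (λ p s → s := p :+ (s :- p)) refl where open +-*-Solver

  p+r-p : ∀ p r → (p ℚ.+ r) ℚ.- p ≡ r
  p+r-p = solve 2 (λ p r → (p :+ r) :- p := r) refl where open +-*-Solver

  lower-< : ∀ (x : ℝ) {p q} → lower x p → ¬ lower x q → p ℚ.< q
  lower-< x {p} {q} p∈x q∉x with ℚ.<-cmp p q
  ... | tri< p<q _ _ = p<q
  ... | tri≈ _ refl _ = ⊥-elim (q∉x p∈x)
  ... | tri> _ _ q<p = ⊥-elim (q∉x (closed x q<p p∈x))

  closed-≤ : ∀ (x : ℝ) {p q} → p ℚ.≤ q → lower x q → lower x p
  closed-≤ x {p} {q} p≤q q∈x with ℚ.<-cmp p q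
  ... | tri< p<q _ _  = closed x p<q q∈x
  ... | tri≈ _ refl _ = q∈x
  ... | tri> _ _ q<p  = ⊥-elim (ℚ.<-irrefl refl (ℚ.<-≤-trans q<p p≤q))

  <-⊓ : ∀ {p q r} → p ℚ.< q → p ℚ.< r → p ℚ.< q ℚ.⊓ r
  <-⊓ {p} {q} {r} p<q p<r with ℚ.⊓-sel q r
  ... | inj₁ eq = subst (p ℚ.<_) (≡.sym eq) p<q
  ... | inj₂ eq = subst (p ℚ.<_) (≡.sym eq) p<r

fromℚ : ℚ → ℝ
fromℚ q .lower     = ℚ._< q
fromℚ q .inhabited = q ℚ.- 1ℚ , q-1<q q
fromℚ q .proper    = q , ℚ.<-irrefl refl
fromℚ q .closed    = ℚ.<-trans
fromℚ q .rounded   = ℚ.<-dense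

0ℝ : ℝ
0ℝ = fromℚ 0ℚ

infixl 6 _+_ _-_
infix  8 -_

_+_ : ℝ → ℝ → ℝ
(x + y) .lower q   = ∃ λ p → ∃ λ r → lower x p × lower y r × q ≡ p ℚ.+ r
(x + y) .inhabited = _ , _ , _ , proj₂ (inhabited x) , proj₂ (inhabited y) , refl
(x + y) .proper    = proj₁ (proper x) ℚ.+ proj₁ (proper y) , λ (p , r , p∈x , r∈y , eq) →
  ℚ.<-irrefl (≡.sym eq) (ℚ.+-mono-< (lower-< x p∈x (proj₂ (proper x)))
                                    (lower-< y r∈y (proj₂ (proper y))))
(x + y) .closed {s} s<q (p , r , p∈x , r∈y , refl) =
  p , s ℚ.- p , p∈x
    , closed y (subst (s ℚ.- p ℚ.<_) (p+r-p p r) (ℚ.+-monoˡ-< (ℚ.- p) s<q)) r∈y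
    , p+s-p p s
(x + y) .rounded (p , r , p∈x , r∈y , refl) =
  let p′ , p<p′ , p′∈x = rounded x p∈x in
  p′ ℚ.+ r , ℚ.+-monoˡ-< r p<p′ , p′ , r , p′∈x , r∈y , refl

-_ : ℝ → ℝ
(- x) .lower q   = ∃ λ r → ¬ lower x r × q ℚ.< ℚ.- r
(- x) .inhabited = _ , proj₁ (proper x) , proj₂ (proper x) , q-1<q _
(- x) .proper    = ℚ.- proj₁ (inhabited x) , λ (r , r∉x , -p<-r) →
  ℚ.<-asym (ℚ.neg-antimono-< (lower-< x (proj₂ (inhabited x)) r∉x)) -p<-r
(- x) .closed p<q (r , r∉x , q<-r) = r , r∉x , ℚ.<-trans p<q q<-r
(- x) .rounded (r , r∉x , p<-r) =
  let q , p<q , q<-r = ℚ.<-dense p<-r in q , p<q , r , r∉x , q<-r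

_-_ : ℝ → ℝ → ℝ
x - y = x + - y

max : ℝ → ℝ → ℝ
max x y .lower q   = lower x q ⊎ lower y q
max x y .inhabited = _ , inj₁ (proj₂ (inhabited x))
max x y .proper    = proj₁ (proper x) ℚ.⊔ proj₁ (proper y) , λ
  { (inj₁ q∈x) → ℚ.<-irrefl refl
      (ℚ.<-≤-trans (lower-< x q∈x (proj₂ (proper x))) (ℚ.p≤p⊔q (proj₁ (proper x)) _))
  ; (inj₂ q∈y) → ℚ.<-irrefl refl
      (ℚ.<-≤-trans (lower-< y q∈y (proj₂ (proper y))) (ℚ.p≤q⊔p (proj₁ (proper x)) _))
  }
max x y .closed p<q (inj₁ q∈x) = inj₁ (closed x p<q q∈x)
max x y .closed p<q (inj₂ q∈y) = inj₂ (closed y p<q q∈y)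
max x y .rounded (inj₁ p∈x) = map₂ (map₂ inj₁) (rounded x p∈x)
max x y .rounded (inj₂ p∈y) = map₂ (map₂ inj₂) (rounded y p∈y)

min : ℝ → ℝ → ℝ
min x y .lower q   = lower x q × lower y q
min x y .inhabited = proj₁ (inhabited x) ℚ.⊓ proj₁ (inhabited y)
  , closed-≤ x (ℚ.p⊓q≤p _ _) (proj₂ (inhabited x))
  , closed-≤ y (ℚ.p⊓q≤q (proj₁ (inhabited x)) _) (proj₂ (inhabited y))
min x y .proper    = proj₁ (proper x) , proj₂ (proper x) ∘ proj₁
min x y .closed p<q (q∈x , q∈y) = closed x p<q q∈x , closed y p<q q∈y
min x y .rounded (p∈x , p∈y) =
  let q , p<q , q∈x = rounded x p∈x
      r , p<r , r∈y = rounded y p∈y in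
  q ℚ.⊓ r , <-⊓ p<q p<r , closed-≤ x (ℚ.p⊓q≤p q r) q∈x , closed-≤ y (ℚ.p⊓q≤q q r) r∈y

∣_∣ : ℝ → ℝ
∣ x ∣ = max x (- x)

ℝ⁺ : Set₁
ℝ⁺ = ∃ λ ε → 0ℝ < ε

private
  variable
    ℓ : Level
    n : ℕ
    x y z w c δ ε : ℝ

≤-refl : x ≤ x
≤-refl = mk≤ id

≤-trans : x ≤ y → y ≤ z → x ≤ z
≤-trans (mk≤ x⊆y) (mk≤ y⊆z) = mk≤ (y⊆z ∘ x⊆y)

≤-<-trans : x ≤ y → y < z → x < z
≤-<-trans (mk≤ x⊆y) (mk< q∈z q∉y) = mk< q∈z (q∉y ∘ x⊆y)

<-≤-trans : x < y → y ≤ z → x < z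
<-≤-trans (mk< q∈y q∉x) (mk≤ y⊆z) = mk< (y⊆z q∈y) q∉x

<⇒≤ : x < y → x ≤ y
<⇒≤ {x} {y} (mk< q∈y q∉x) = mk≤ λ p∈x → closed y (lower-< x p∈x q∉x) q∈y

<-trans : x < y → y < z → x < z
<-trans x<y y<z = ≤-<-trans (<⇒≤ x<y) y<z

<⇒≱ : x < y → ¬ (y ≤ x)
<⇒≱ (mk< q∈y q∉x) (mk≤ y⊆x) = q∉x (y⊆x q∈y)

≈-isEquivalence : IsEquivalence _≈_
≈-isEquivalence = record
  { refl  = ≤-refl , ≤-refl
  ; sym   = swap
  ; trans = λ (x≤y , y≤x) (y≤z , z≤y) → ≤-trans x≤y y≤z , ≤-trans z≤y y≤x
  }

open IsEquivalence ≈-isEquivalence public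
  using () renaming (refl to ≈-refl; sym to ≈-sym; trans to ≈-trans)

≤-isPartialOrder : IsPartialOrder _≈_ _≤_
≤-isPartialOrder = record
  { isPreorder = record
    { isEquivalence = ≈-isEquivalence
    ; reflexive     = proj₁
    ; trans         = ≤-trans
    }
  ; antisym = _,_
  }

+-mono-≤ : x ≤ y → z ≤ w → x + z ≤ y + w
+-mono-≤ (mk≤ x⊆y) (mk≤ z⊆w) = mk≤ λ (p , r , p∈x , r∈z , eq) → p , r , x⊆y p∈x , z⊆w r∈z , eq

+-comm : ∀ x y → x + y ≈ y + x
+-comm x y = flip x y , flip y x
  where
  flip : ∀ x y → x + y ≤ y + x
  flip x y = mk≤ λ (p , r , p∈x , r∈y , eq) → r , p , r∈y , p∈x , ≡.trans eq (ℚ.+-comm p r)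

+-assoc : ∀ x y z → (x + y) + z ≈ x + (y + z)
+-assoc x y z =
  mk≤ (λ { (_ , s , (p , r , p∈x , r∈y , refl) , s∈z , refl) →
    p , r ℚ.+ s , p∈x , (r , s , r∈y , s∈z , refl) , ℚ.+-assoc p r s }) ,
  mk≤ (λ { (p , _ , p∈x , (r , s , r∈y , s∈z , refl) , refl) →
    p ℚ.+ r , s , (p , r , p∈x , r∈y , refl) , s∈z , ≡.sym (ℚ.+-assoc p r s) })

+-identityʳ : ∀ x → x + 0ℝ ≈ x
+-identityʳ x =
  mk≤ (λ { (p , r , p∈x , r<0 , refl) →
    closed x (subst (p ℚ.+ r ℚ.<_) (ℚ.+-identityʳ p) (ℚ.+-monoʳ-< p r<0)) p∈x }) ,
  mk≤ (λ {p} p∈x → let q , p<q , q∈x = rounded x p∈x in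
    q , p ℚ.- q , q∈x
      , subst (p ℚ.- q ℚ.<_) (ℚ.+-inverseʳ q) (ℚ.+-monoˡ-< (ℚ.- q) p<q)
      , p+s-p q p)

-‿anti-≤ : x ≤ y → - y ≤ - x
-‿anti-≤ (mk≤ x⊆y) = mk≤ λ (r , r∉y , q<-r) → r , r∉y ∘ x⊆y , q<-r

private
  natℚ : ℕ → ℚ
  natℚ n = ℚ.fromℚᵘ (ℚᵘ.mkℚᵘ (+ n) 0)

  natℚ-suc : ∀ n → natℚ (suc n) ≡ 1ℚ ℚ.+ natℚ n
  natℚ-suc n = ℚ.toℚᵘ-injective (ℚᵘ.≃-trans (ℚ.toℚᵘ-fromℚᵘ _) (ℚᵘ.≃-sym
    (ℚᵘ.≃-trans (ℚ.toℚᵘ-homo-+ 1ℚ (natℚ n))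
    (ℚᵘ.≃-trans (ℚᵘ.+-congʳ (ℚ.toℚᵘ 1ℚ) (ℚ.toℚᵘ-fromℚᵘ (ℚᵘ.mkℚᵘ (+ n) 0)))
      (ℚᵘ.*≡* {ℚ.toℚᵘ 1ℚ ℚᵘ.+ ℚᵘ.mkℚᵘ (+ n) 0} {ℚᵘ.mkℚᵘ (+ suc n) 0}
        (cong (λ k → (+ 1 ℤ.+ k) ℤ.* + 1) (ℤ.*-identityʳ (+ n))))))))

  archimedean : ∀ q → ∃ λ n → q ℚ.< natℚ n
  archimedean q@(mkℚ m d _) = suc ℤ.∣ m ∣ , ℚ.toℚᵘ-cancel-< (ℚᵘ.<-respʳ-≃
      (ℚᵘ.≃-sym (ℚ.toℚᵘ-fromℚᵘ (ℚᵘ.mkℚᵘ (+ suc ℤ.∣ m ∣) 0)))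
      (ℚᵘ.*<* (lem m)))
    where
    i≤∣i∣ : ∀ i → i ℤ.≤ + ℤ.∣ i ∣
    i≤∣i∣ (+ n)      = ℤ.≤-refl
    i≤∣i∣ -[1+ n ] = ℤ.-≤+

    lem : ∀ m → m ℤ.* + 1 ℤ.< + suc ℤ.∣ m ∣ ℤ.* + suc d
    lem m = ℤ.≤-<-trans (ℤ.≤-reflexive (ℤ.*-identityʳ m)) (ℤ.≤-<-trans (i≤∣i∣ m)
      (ℤ.<-≤-trans (ℤ.+<+ (ℕ.n<1+n _)) (ℤ.+≤+ (ℕ.m≤m*n (suc ℤ.∣ m ∣) (suc d)))))

record Connective (k : ℕ) : Set₁ where
  field
    fun        : Vec ℝ k → ℝ
    continuous : ∀ xs (ε : ℝ⁺) → ∃ λ (δ : ℝ⁺) →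
                 ∀ ys → Pointwise (λ x y → ∣ x - y ∣ < proj₁ δ) xs ys → ∣ fun xs - fun ys ∣ < proj₁ ε

-- Constants are function symbols of arity 0.  The metric has the prescribed bound
-- diameter; the predicate p takes values in [- predBound p , predBound p].
record Signature ℓ : Set (lsuc ℓ) where
  field
    diameter    : ℝ
    FunSym      : Set ℓ
    funArity    : FunSym → ℕ
    funModulus  : FunSym → ℝ⁺ → ℝ⁺
    PredSym     : Set ℓ
    predArity   : PredSym → ℕ
    predBound   : PredSym → ℝ
    predModulus : PredSym → ℝ⁺ → ℝ⁺

module _ {a} {A : Set a} (d : A → A → ℝ) where

  Cauchy : (ℕ → A) → Set₁
  Cauchy s = ∀ (ε : ℝ⁺) → ∃ λ N → ∀ m n → N ℕ.≤ m → N ℕ.≤ n → d (s m) (s n) < proj₁ ε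

  ConvergesTo : (ℕ → A) → A → Set₁
  ConvergesTo s l = ∀ (ε : ℝ⁺) → ∃ λ N → ∀ n → N ℕ.≤ n → d (s n) l < proj₁ ε

  Complete : Set (a Level.⊔ lsuc 0ℓ)
  Complete = ∀ s → Cauchy s → ∃ (ConvergesTo s)

-- Domains are setoids, with _≐_ as equality: quotients are taken by changing _≐_.
-- fun and pred respect _≐_ because they are uniformly continuous.  A modulus of
-- uniform continuity sends ε to some δ such that arguments coordinatewise at distance
-- < δ have images at distance ≤ ε.
record Structure (L : Signature ℓ) : Set (lsuc ℓ) where
  open Signature L
  infix 4 _≐_
  field
    Domain    : Set ℓ
    _≐_       : Rel Domain ℓ
    dist      : Domain → Domain → ℝ
    isMetric  : IsGeneralMetric _≐_ _≈_ _≤_ 0ℝ _+_ dist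
    nonempty  : Domain
    dist-≤    : ∀ a b → dist a b ≤ diameter
    complete  : Complete dist
    fun       : (f : FunSym) → Vec Domain (funArity f) → Domain
    fun-unif  : ∀ f (ε : ℝ⁺) {as bs} → Pointwise (λ a b → dist a b < proj₁ (funModulus f ε)) as bs →
                dist (fun f as) (fun f bs) ≤ proj₁ ε
    pred      : (p : PredSym) → Vec Domain (predArity p) → ℝ
    pred-≤    : ∀ p as → ∣ pred p as ∣ ≤ predBound p
    pred-unif : ∀ p (ε : ℝ⁺) {as bs} → Pointwise (λ a b → dist a b < proj₁ (predModulus p ε)) as bs →
                ∣ pred p as - pred p bs ∣ ≤ proj₁ ε

record Filter (I : Set ℓ) : Set (lsuc ℓ) where
  field
    sets   : Pred (Pred I ℓ) ℓ
    full   : U ∈ sets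
    upward : ∀ {J K} → J ⊆ K → J ∈ sets → K ∈ sets
    inter  : ∀ {J K} → J ∈ sets → K ∈ sets → (J ∩ K) ∈ sets
    proper : ∅ ∉ sets
open Filter using (sets)

module Syntax (L : Signature ℓ) where
  open Signature L

  data Term (n : ℕ) : Set ℓ where
    var : Fin n → Term n
    app : (f : FunSym) → Vec (Term n) (funArity f) → Term n

  -- The index is the number of free variables; supᶠ and infᶠ bind variable 0 and
  -- shift the others down by one.
  data Formula : ℕ → Set (lsuc ℓ) where
    distᶠ : Term n → Term n → Formula n
    predᶠ : (p : PredSym) → Vec (Term n) (predArity p) → Formula n
    connᶠ : ∀ {k} → Connective k → Vec (Formula n) k → Formula n
    supᶠ infᶠ : Formula (suc n) → Formula n
open Syntax public

-- Suprema of arbitrary bounded families exist only classically.  Since excluded middle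
-- is assumed for all types, it also yields choice.
module ContinuousLogic (lem : ∀ {ℓ} → ExcludedMiddle ℓ) where

  private
    variable
      A : Set ℓ
      L : Signature ℓ

    archimedean-step : ∀ (x : ℝ) ε → 0ℚ ℚ.< ε → ∃ λ p → lower x p × ¬ lower x (p ℚ.+ ε)
    archimedean-step x ε 0<ε with lem {P = ∃ λ p → lower x p × ¬ lower x (p ℚ.+ ε)}
    ... | yes found = found
    ... | no  none  = ⊥-elim (proj₂ (proper x) (closed x b<a+kε (climb k)))
      where
      instance
        ε-positive : ℚ.Positive ε
        ε-positive = ℚ.positive 0<ε
        ε-nonZero : ℚ.NonZero ε
        ε-nonZero = ℚ.pos⇒nonZero ε
      a = proj₁ (inhabited x)
      b = proj₁ (proper x)
      climb : ∀ n → lower x (a ℚ.+ natℚ n ℚ.* ε)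
      climb zero    = subst (lower x) (solve 2 (λ a ε → a := a :+ con 0ℚ :* ε) refl a ε) (proj₂ (inhabited x))
        where open +-*-Solver
      climb (suc n) with lem {P = lower x (a ℚ.+ natℚ (suc n) ℚ.* ε)}
      ... | yes p = p
      ... | no  ¬p = ⊥-elim (none (_ , climb n , ¬p ∘ subst (lower x)
              (≡.trans (solve 3 (λ a k ε → (a :+ k :* ε) :+ ε := a :+ (con 1ℚ :+ k) :* ε) refl a (natℚ n) ε)
                       (cong (λ k → a ℚ.+ k ℚ.* ε) (≡.sym (natℚ-suc n))))))
        where open +-*-Solver
      t = (b ℚ.- a) ℚ.* ℚ.1/ ε
      k = proj₁ (archimedean t)
      tε : a ℚ.+ t ℚ.* ε ≡ b
      tε = ≡.trans (cong (a ℚ.+_) (≡.trans (ℚ.*-assoc (b ℚ.- a) (ℚ.1/ ε) ε)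
             (≡.trans (cong ((b ℚ.- a) ℚ.*_) (ℚ.*-inverseˡ ε)) (ℚ.*-identityʳ _)))) (≡.sym (p+s-p a b))
      b<a+kε : b ℚ.< a ℚ.+ natℚ k ℚ.* ε
      b<a+kε = subst (λ c → c ℚ.< a ℚ.+ natℚ k ℚ.* ε) tε (ℚ.+-monoʳ-< a (ℚ.*-monoˡ-<-pos ε (proj₂ (archimedean t))))

  +-inverseʳ : ∀ x → x - x ≈ 0ℝ
  +-inverseʳ x =
    mk≤ (λ { (p , s , p∈x , (r , r∉x , s<-r) , refl) →
      subst (p ℚ.+ s ℚ.<_) (ℚ.+-inverseʳ r) (ℚ.+-mono-< (lower-< x p∈x r∉x) s<-r) }) ,
    mk≤ (λ {q} q<0 →
      let m , q<m , m<0 = ℚ.<-dense q<0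
          p , p∈x , r∉x = archimedean-step x (ℚ.- m) (ℚ.neg-antimono-< m<0) in
      p , q ℚ.- p , p∈x
        , (p ℚ.- m , r∉x , subst (q ℚ.- p ℚ.<_)
             (solve 2 (λ m p → m :- p := :- (p :- m)) refl m p) (ℚ.+-monoˡ-< (ℚ.- p) q<m))
        , p+s-p p q)
    where open +-*-Solver

  +-0-abelianGroup : AbelianGroup _ _
  +-0-abelianGroup = record
    { Carrier = ℝ ; _≈_ = _≈_ ; _∙_ = _+_ ; ε = 0ℝ ; _⁻¹ = -_
    ; isAbelianGroup = record
      { isGroup = record
        { isMonoid = record
          { isSemigroup = record
            { isMagma = record
              { isEquivalence = ≈-isEquivalence
              ; ∙-cong = λ (x≤y , y≤x) (u≤v , v≤u) → +-mono-≤ x≤y u≤v , +-mono-≤ y≤x v≤u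
              }
            ; assoc = +-assoc
            }
          ; identity = (λ x → ≈-trans (+-comm 0ℝ x) (+-identityʳ x)) , +-identityʳ
          }
        ; inverse = (λ x → ≈-trans (+-comm (- x) x) (+-inverseʳ x)) , +-inverseʳ
        ; ⁻¹-cong = λ (x≤y , y≤x) → -‿anti-≤ y≤x , -‿anti-≤ x≤y
        }
      ; comm = +-comm
      }
    }

  open AbelianGroupProperties +-0-abelianGroup using (⁻¹-involutive; ⁻¹-∙-comm; //-rightDividesʳ; //-rightDividesˡ)
  open CommutativeSemigroupProperties (AbelianGroup.commutativeSemigroup +-0-abelianGroup) public using (interchange)

  ≮⇒≥ : ¬ (x < y) → y ≤ x
  ≮⇒≥ x≮y = mk≤ λ q∈y → decidable-stable lem λ q∉x → x≮y (mk< q∈y q∉x)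

  ≰⇒> : ¬ (x ≤ y) → y < x
  ≰⇒> x≰y = decidable-stable lem (x≰y ∘ ≮⇒≥)

  +-monoˡ-≤ : x ≤ y → x + z ≤ y + z
  +-monoˡ-≤ x≤y = +-mono-≤ x≤y ≤-refl

  +-cancelʳ-≤ : ∀ z → x + z ≤ y + z → x ≤ y
  +-cancelʳ-≤ {x} {y} z x+z≤y+z = ≤-trans (proj₂ (//-rightDividesʳ z x))
    (≤-trans (+-monoˡ-≤ x+z≤y+z) (proj₁ (//-rightDividesʳ z y)))

  +-monoˡ-< : x < y → x + z < y + z
  +-monoˡ-< {z = z} x<y = ≰⇒> λ y+z≤x+z → <⇒≱ x<y (+-cancelʳ-≤ z y+z≤x+z)

  +-monoʳ-< : y < z → x + y < x + z
  +-monoʳ-< {y} {z} {x} y<z = ≤-<-trans (proj₁ (+-comm x y)) (<-≤-trans (+-monoˡ-< y<z) (proj₁ (+-comm z x)))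

  +-mono-< : x < y → z < w → x + z < y + w
  +-mono-< x<y z<w = <-trans (+-monoˡ-< x<y) (+-monoʳ-< z<w)

  x<x+ε : 0ℝ < ε → x < x + ε
  x<x+ε {ε} {x} 0<ε = ≤-<-trans (proj₂ (+-identityʳ x)) (+-monoʳ-< 0<ε)

  x-y≤z⇒x≤z+y : x - y ≤ z → x ≤ z + y
  x-y≤z⇒x≤z+y {x} {y} h = ≤-trans (proj₂ (//-rightDividesˡ y x)) (+-monoˡ-≤ h)

  x≤z+y⇒x-y≤z : x ≤ z + y → x - y ≤ z
  x≤z+y⇒x-y≤z {x} {z} {y} h = ≤-trans (+-monoˡ-≤ h) (proj₁ (//-rightDividesʳ y z))

  x-y<z⇒x<z+y : x - y < z → x < z + y
  x-y<z⇒x<z+y h = ≰⇒> λ z+y≤x → <⇒≱ h (+-cancelʳ-≤ _ (≤-trans z+y≤x (x-y≤z⇒x≤z+y ≤-refl)))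

  x<z+y⇒x-y<z : x < z + y → x - y < z
  x<z+y⇒x-y<z h = ≰⇒> λ z≤x-y → <⇒≱ h (≤-trans (+-monoˡ-≤ z≤x-y) (proj₁ (//-rightDividesˡ _ _)))

  -[x-y]≈y-x : ∀ x y → - (x - y) ≈ y - x
  -[x-y]≈y-x x y = ≈-trans (≈-sym (⁻¹-∙-comm x (- y)))
    (≈-trans (AbelianGroup.∙-congˡ +-0-abelianGroup (⁻¹-involutive y)) (+-comm (- x) y))

  x≤max : x ≤ max x y
  x≤max = mk≤ inj₁

  y≤max : y ≤ max x y
  y≤max = mk≤ inj₂

  max-lub : x ≤ z → y ≤ z → max x y ≤ z
  max-lub (mk≤ x⊆z) (mk≤ y⊆z) = mk≤ [ x⊆z , y⊆z ]

  max-lub-< : x < z → y < z → max x y < z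
  max-lub-< {x} {z} {y} x<z y<z with lem {P = x ≤ y}
  ... | yes x≤y = ≤-<-trans (max-lub x≤y ≤-refl) y<z
  ... | no  x≰y = ≤-<-trans (max-lub ≤-refl (<⇒≤ (≰⇒> x≰y))) x<z

  min≤x : min x y ≤ x
  min≤x = mk≤ proj₁

  min≤y : min x y ≤ y
  min≤y = mk≤ proj₂

  min-glb : z ≤ x → z ≤ y → z ≤ min x y
  min-glb (mk≤ z⊆x) (mk≤ z⊆y) = mk≤ λ q∈z → z⊆x q∈z , z⊆y q∈z

  ∣-∣<⇒< : ∣ x - y ∣ < ε → x < ε + y × y < ε + x
  ∣-∣<⇒< {x} {y} h =
    x-y<z⇒x<z+y (≤-<-trans x≤max h) ,
    x-y<z⇒x<z+y (≤-<-trans (≤-trans (proj₂ (-[x-y]≈y-x x y)) y≤max) h)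

  <⇒∣-∣< : x < ε + y → y < ε + x → ∣ x - y ∣ < ε
  <⇒∣-∣< {x} {ε} {y} h k =
    max-lub-< (x<z+y⇒x-y<z h) (≤-<-trans (proj₁ (-[x-y]≈y-x x y)) (x<z+y⇒x-y<z k))

  ∣-∣≤⇒≤ : ∣ x - y ∣ ≤ ε → x ≤ ε + y × y ≤ ε + x
  ∣-∣≤⇒≤ {x} {y} h =
    x-y≤z⇒x≤z+y (≤-trans x≤max h) ,
    x-y≤z⇒x≤z+y (≤-trans (≤-trans (proj₂ (-[x-y]≈y-x x y)) y≤max) h)

  ≤⇒∣-∣≤ : x ≤ ε + y → y ≤ ε + x → ∣ x - y ∣ ≤ ε
  ≤⇒∣-∣≤ {x} {ε} {y} h k =
    max-lub (x≤z+y⇒x-y≤z h) (≤-trans (proj₁ (-[x-y]≈y-x x y)) (x≤z+y⇒x-y≤z k))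

  half : ℝ⁺ → ℝ⁺
  half (ε , mk< q∈ε q≮0) = fromℚ (½ ℚ.* q′) , mk< 0<q′/2 (ℚ.<-irrefl refl)
    where
    q′ = proj₁ (rounded ε q∈ε)
    0<q′/2 : 0ℚ ℚ.< ½ ℚ.* q′
    0<q′/2 = subst (λ c → c ℚ.< ½ ℚ.* q′) (ℚ.*-zeroʳ ½) (ℚ.*-monoʳ-<-pos ½ (ℚ.≤-<-trans (ℚ.≮⇒≥ q≮0) (proj₁ (proj₂ (rounded ε q∈ε)))))

  half+half : ∀ ε → proj₁ (half ε) + proj₁ (half ε) ≤ proj₁ ε
  half+half (ε , mk< q∈ε q≮0) = mk≤ λ { (p , r , p< , r< , refl) →
    closed ε (subst (p ℚ.+ r ℚ.<_) (solve 1 (λ q → con ½ :* q :+ con ½ :* q := q) refl _) (ℚ.+-mono-< p< r<))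
      (proj₂ (proj₂ (rounded ε q∈ε))) }
    where open +-*-Solver

  half< : ∀ ε → proj₁ (half ε) < proj₁ ε
  half< ε = <-≤-trans (x<x+ε (proj₂ (half ε))) (half+half ε)

  ≤-ε : (∀ (ε : ℝ⁺) → x ≤ y + proj₁ ε) → x ≤ y
  ≤-ε {x} {y} h = ≮⇒≥ λ y<x →
    let ε = x - y , ≰⇒> λ x-y≤0 → <⇒≱ y<x (≤-trans (x-y≤z⇒x≤z+y x-y≤0) (≤-trans (proj₁ (+-comm 0ℝ y)) (proj₁ (+-identityʳ y)))) in
    <⇒≱ (half< ε) (x≤z+y⇒x-y≤z (≤-trans (h (half ε)) (proj₁ (+-comm _ _))))

  IsUpperBound IsLowerBound : (A → ℝ) → ℝ → Set _
  IsUpperBound f b = ∀ a → f a ≤ b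
  IsLowerBound f b = ∀ a → b ≤ f a

  -- The least upper bound when f is bounded above and A is inhabited, and 0 otherwise.
  sup-dec : (f : A → ℝ) → Dec (A × ∃ (IsUpperBound f)) → ℝ
  sup-dec f (no _)               = 0ℝ
  sup-dec f (yes (a , b , f≤b)) .lower = λ q → True (lem {P = ∃ λ a → lower (f a) q})
  sup-dec f (yes (a , b , f≤b)) .inhabited = proj₁ (inhabited (f a)) , fromWitness (a , proj₂ (inhabited (f a)))
  sup-dec f (yes (a , b , f≤b)) .proper = proj₁ (proper b) , λ q∈f → proj₂ (proper b) (≤⇒⊆ (f≤b _) (proj₂ (toWitness q∈f)))
  sup-dec f (yes (a , b , f≤b)) .closed = λ p<q q∈f → let a , q∈fa = toWitness q∈f in fromWitness (a , closed (f a) p<q q∈fa)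
  sup-dec f (yes (a , b , f≤b)) .rounded = λ p∈f →
    let a , p∈fa = toWitness p∈f
        q , p<q , q∈fa = rounded (f a) p∈fa in
    q , p<q , fromWitness (a , q∈fa)

  sup inf : (A → ℝ) → ℝ
  sup f = sup-dec f lem
  inf f = - sup (λ a → - f a)

  ≤-sup : (f : A → ℝ) → ∃ (IsUpperBound f) → IsUpperBound f (sup f)
  ≤-sup f bounded a = go lem
    where
    go : ∀ dec → f a ≤ sup-dec f dec
    go (no ¬h)   = ⊥-elim (¬h (a , bounded))
    go (yes _)   = mk≤ λ q∈fa → fromWitness (a , q∈fa)

  sup-≤ : (f : A → ℝ) → A → ∀ {b} → IsUpperBound f b → sup f ≤ b
  sup-≤ f a {b} f≤b = go lem
    where
    go : ∀ dec → sup-dec f dec ≤ b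
    go (no ¬h)   = ⊥-elim (¬h (a , b , f≤b))
    go (yes _)   = mk≤ λ q∈f → ≤⇒⊆ (f≤b _) (proj₂ (toWitness q∈f))

  inf-≤ : (f : A → ℝ) → ∃ (IsLowerBound f) → IsLowerBound f (inf f)
  inf-≤ f (b , b≤f) a = ≤-trans
    (-‿anti-≤ (≤-sup (-_ ∘ f) (- b , λ a → -‿anti-≤ (b≤f a)) a))
    (proj₁ (⁻¹-involutive (f a)))

  ≤-inf : (f : A → ℝ) → A → ∀ {b} → IsLowerBound f b → b ≤ inf f
  ≤-inf f a {b} b≤f = ≤-trans (proj₂ (⁻¹-involutive b))
    (-‿anti-≤ (sup-≤ (-_ ∘ f) a (λ a → -‿anti-≤ (b≤f a))))

  ∣∣≤⇒-≤ : ∣ x ∣ ≤ y → - y ≤ x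
  ∣∣≤⇒-≤ {x} h = ≤-trans (-‿anti-≤ (≤-trans y≤max h)) (proj₁ (⁻¹-involutive x))

  -≤⇒∣∣≤ : - y ≤ x → x ≤ y → ∣ x ∣ ≤ y
  -≤⇒∣∣≤ {y} h k = max-lub k (≤-trans (-‿anti-≤ h) (proj₁ (⁻¹-involutive y)))

  halves : ℕ → ℝ⁺
  halves zero    = fromℚ 1ℚ , mk< {between = 0ℚ} (ℚ.positive⁻¹ 1ℚ) (ℚ.<-irrefl refl)
  halves (suc k) = half (halves k)

  halves-null : (ε : ℝ⁺) → ∃ λ k → proj₁ (halves k) < proj₁ ε
  halves-null (ε , 0<ε) = decidable-stable lem λ none →
    let ε≤ : IsLowerBound (proj₁ ∘ halves) ε
        ε≤ k = decidable-stable lem λ ε≰ → none (k , ≰⇒> ε≰)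
        L    = inf (proj₁ ∘ halves)
        L≤   = inf-≤ (proj₁ ∘ halves) (ε , ε≤)
        L+L≤ = ≤-inf (proj₁ ∘ halves) 0 λ k →
                 ≤-trans (+-mono-≤ (L≤ (suc k)) (L≤ (suc k))) (half+half (halves k)) in
    <⇒≱ (x<x+ε {x = L} (<-≤-trans 0<ε (≤-inf (proj₁ ∘ halves) 0 ε≤))) L+L≤

  ≤-poset : Poset _ _ _
  ≤-poset = record { isPartialOrder = ≤-isPartialOrder }

  module ≤-Reasoning = PosetReasoning ≤-poset

  constᶜ : ℝ → Connective 0
  constᶜ x = record
    { fun        = λ _ → x
    ; continuous = λ _ ε → ε , λ _ _ → let h = <-≤-trans (x<x+ε (proj₂ ε)) (proj₁ (+-comm _ _)) in <⇒∣-∣< h h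
    }

  maxᶜ : Connective 2
  maxᶜ = record
    { fun        = λ { (x ∷ y ∷ []) → max x y }
    ; continuous = λ { (x ∷ y ∷ []) ε → ε , λ { (x′ ∷ y′ ∷ []) (h ∷ k ∷ []) →
        let x< , <x = ∣-∣<⇒< h
            y< , <y = ∣-∣<⇒< k in
        <⇒∣-∣< (max-< x< y<) (max-< <x <y) } }
    }
    where
    max-< : x < ε + z → y < ε + w → max x y < ε + max z w
    max-< h k = max-lub-< (<-≤-trans h (+-mono-≤ ≤-refl x≤max)) (<-≤-trans k (+-mono-≤ ≤-refl y≤max))

  minᶜ : Connective 2
  minᶜ = record
    { fun        = λ { (x ∷ y ∷ []) → min x y }
    ; continuous = λ { (x ∷ y ∷ []) ε → ε , λ { (x′ ∷ y′ ∷ []) (h ∷ k ∷ []) →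
        let x< , <x = ∣-∣<⇒< h
            y< , <y = ∣-∣<⇒< k in
        <⇒∣-∣< (min-< x< y<) (min-< <x <y) } }
    }
    where
    min-< : x < ε + z → y < ε + w → min x y < ε + min z w
    min-< {z = z} {w = w} h k with lem {P = z ≤ w}
    ... | yes z≤w = ≤-<-trans min≤x (<-≤-trans h (+-mono-≤ ≤-refl (min-glb ≤-refl z≤w)))
    ... | no  z≰w = ≤-<-trans min≤y (<-≤-trans k (+-mono-≤ ≤-refl (min-glb (<⇒≤ (≰⇒> z≰w)) ≤-refl)))

  module _ (M : Structure L) where
    open Structure M

    term  : Term L n → Vec Domain n → Domain
    terms : ∀ {k} → Vec (Term L n) k → Vec Domain n → Vec Domain k
    term (var x)    ρ = Vec.lookup ρ x
    term (app f ts) ρ = fun f (terms ts ρ)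
    terms []       ρ = []
    terms (t ∷ ts) ρ = term t ρ ∷ terms ts ρ

    value  : Formula L n → Vec Domain n → ℝ
    values : ∀ {k} → Vec (Formula L n) k → Vec Domain n → Vec ℝ k
    value (distᶠ t u)  ρ = dist (term t ρ) (term u ρ)
    value (predᶠ p ts) ρ = pred p (terms ts ρ)
    value (connᶠ C φs) ρ = Connective.fun C (values φs ρ)
    value (supᶠ φ)     ρ = sup λ b → value φ (b ∷ ρ)
    value (infᶠ φ)     ρ = inf λ b → value φ (b ∷ ρ)
    values []       ρ = []
    values (φ ∷ φs) ρ = value φ ρ ∷ values φs ρ

  module _ {I : Set ℓ} (F : Filter I) where

    limsup : (I → ℝ) → ℝ
    limsup u = inf {A = ∃ (sets F)} λ (J , _) → sup {A = ∃ J} λ (i , _) → u i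

    Eventually : ∀ {p} → Pred I p → Set _
    Eventually P = ∃ λ J → J ∈ sets F × J ⊆ P

    private
      variable
        u v t : I → ℝ
        a b : Level
        P Q R : Pred I a

    Bounded : (I → ℝ) → Set _
    Bounded u = ∃ (IsLowerBound u) × ∃ (IsUpperBound u)

    always : (∀ i → i ∈ P) → Eventually P
    always h = U , Filter.full F , λ _ → h _

    map₁ : P ⊆ Q → Eventually P → Eventually Q
    map₁ f (J , J∈F , J⊆P) = J , J∈F , f ∘ J⊆P

    both : Eventually P → Eventually Q → Eventually (P ∩ Q)
    both (J , J∈F , J⊆P) (K , K∈F , K⊆Q) = J ∩ K , Filter.inter F J∈F K∈F , λ (i∈J , i∈K) → J⊆P i∈J , K⊆Q i∈K

    all< : {P : ℕ → Pred I a} → (∀ j → Eventually (P j)) → ∀ m → Eventually (λ i → ∀ j → j ℕ.< m → P j i)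
    all< h zero    = always λ _ _ ()
    all< {P = P} h (suc m) = map₁ step (both (h m) (all< h m))
      where
      step : ∀ {i} → P m i × (∀ j → j ℕ.< m → P j i) → ∀ j → j ℕ.< suc m → P j i
      step (p , f) j j<1+m with ℕ.m≤n⇒m<n∨m≡n (ℕ.≤-pred j<1+m)
      ... | inj₁ j<m  = f j j<m
      ... | inj₂ refl = p

    witness : ∀ {J} → J ∈ sets F → ∃ J
    witness J∈F = decidable-stable lem λ ¬∃ → Filter.proper F (Filter.upward F (λ i∈J → ⊥-elim (¬∃ (_ , i∈J))) J∈F)

    limsup-≤ : Bounded u → Eventually (λ i → u i ≤ c) → limsup u ≤ c
    limsup-≤ {u} {c} ((lo , lo≤u) , hi , u≤hi) (J , J∈F , J⊆) = ≤-trans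
      (inf-≤ _ (lo , λ (K , K∈F) → let i∈K = witness K∈F in
        ≤-trans (lo≤u (proj₁ i∈K)) (≤-sup (λ (i , _) → u i) (hi , λ (i , _) → u≤hi i) i∈K)) (J , J∈F))
      (sup-≤ (λ (i , _) → u i) (witness J∈F) (λ (i , i∈J) → J⊆ i∈J))

    ≤-limsup′ : Bounded u → (∀ J → J ∈ sets F → ∃ λ i → J i × c ≤ u i) → c ≤ limsup u
    ≤-limsup′ {u} (_ , hi , u≤hi) h = ≤-inf _ (U , Filter.full F) λ (J , J∈F) →
      let i , i∈J , c≤ui = h J J∈F in
      ≤-trans c≤ui (≤-sup (λ (i , _) → u i) (hi , λ (i , _) → u≤hi i) (i , i∈J))

    ≤-limsup : Bounded u → (∀ i → c ≤ u i) → c ≤ limsup u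
    ≤-limsup bu h = ≤-limsup′ bu λ J J∈F → let i , i∈J = witness J∈F in i , i∈J , h i

    limsup-< : Bounded u → limsup u < c → Eventually (λ i → u i < c)
    limsup-< {u} {c} bu lim<c = decidable-stable lem λ none → <⇒≱ lim<c (≤-limsup′ bu λ J J∈F →
      decidable-stable lem λ ¬∃ → none (J , J∈F , λ {i} i∈J → ≰⇒> λ c≤ui → ¬∃ (i , i∈J , c≤ui)))

    limsup-ε : Bounded u → (ε : ℝ⁺) → Eventually (λ i → u i ≤ limsup u + proj₁ ε)
    limsup-ε bu (_ , 0<ε) = map₁ <⇒≤ (limsup-< bu (x<x+ε 0<ε))

    limsup-≤-+ : Bounded u → Bounded v → Bounded t → Eventually (λ i → u i ≤ v i + t i) → limsup u ≤ limsup v + limsup t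
    limsup-≤-+ {u} {v} {t} bu bv bt ev = ≤-ε λ ε → limsup-≤ bu (map₁
      (λ (p , q , r) → ≤-trans p (≤-trans (+-mono-≤ q r) (≤-trans (proj₁ (interchange _ _ _ _)) (+-mono-≤ ≤-refl (half+half ε)))))
      (both ev (both (limsup-ε bv (half ε)) (limsup-ε bt (half ε)))))

    limsup-≤-shift : Bounded u → Bounded v → Eventually (λ i → u i ≤ c + v i) → limsup u ≤ c + limsup v
    limsup-≤-shift {u} {v} {c} bu bv ev = ≤-ε λ ε → limsup-≤ bu (map₁
      (λ (p , q) → ≤-trans p (≤-trans (+-mono-≤ ≤-refl q) (proj₂ (+-assoc _ _ _))))
      (both ev (limsup-ε bv ε)))

  module ReducedProduct {L : Signature ℓ} {I : Set ℓ} (F : Filter I) (M : I → Structure L) where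
    open Signature L
    private
      module M i = Structure (M i)
      module Met i = IsGeneralMetric (M.isMetric i)

    Domain : Set _
    Domain = ∀ i → M.Domain i

    dist : Domain → Domain → ℝ
    dist a b = limsup F λ i → M.dist i (a i) (b i)

    private variable a b : Domain

    bounded : Bounded F (λ i → M.dist i (a i) (b i))
    bounded = (0ℝ , λ i → Met.nonNegative i) , diameter , λ i → M.dist-≤ i _ _

    dist-≤-ev : Eventually F (λ i → M.dist i (a i) (b i) ≤ x) → dist a b ≤ x
    dist-≤-ev = limsup-≤ F bounded

    dist-<-ev : dist a b < x → Eventually F (λ i → M.dist i (a i) (b i) < x)
    dist-<-ev = limsup-< F bounded

    0≤dist : 0ℝ ≤ dist a b
    0≤dist = ≤-limsup F bounded λ i → Met.nonNegative i

    ≈0 : dist a b ≤ 0ℝ → dist a b ≈ 0ℝ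
    ≈0 h = h , 0≤dist

    triangle : ∀ a b c → dist a c ≤ dist a b + dist b c
    triangle a b c = limsup-≤-+ F bounded bounded bounded (always F λ i → Met.triangle i _ _ _)

    dist-sym-≤ : ∀ a b → dist a b ≤ dist b a
    dist-sym-≤ a b = ≤-ε λ ε → dist-≤-ev (map₁ F (≤-trans (proj₁ (Met.sym _ _ _))) (limsup-ε F bounded ε))

    0-trans : ∀ {a b c} → dist a b ≈ 0ℝ → dist b c ≈ 0ℝ → dist a c ≈ 0ℝ
    0-trans ab bc = ≈0 (≤-trans (triangle _ _ _)
      (≤-trans (+-mono-≤ (proj₁ ab) (proj₁ bc)) (proj₁ (+-identityʳ 0ℝ))))

    0-sym : ∀ {a b} → dist a b ≈ 0ℝ → dist b a ≈ 0ℝ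
    0-sym ab = ≈0 (≤-trans (dist-sym-≤ _ _) (proj₁ ab))

    cong-≤ : ∀ {a a′ b b′} → dist a a′ ≈ 0ℝ → dist b b′ ≈ 0ℝ → dist a b ≤ dist a′ b′
    cong-≤ {a} {a′} {b} {b′} aa′ bb′ = begin
      dist a b                                ≤⟨ triangle a a′ b ⟩
      dist a a′ + dist a′ b                   ≤⟨ +-mono-≤ (proj₁ aa′) (triangle a′ b′ b) ⟩
      0ℝ + (dist a′ b′ + dist b′ b)           ≤⟨ +-mono-≤ ≤-refl (+-mono-≤ ≤-refl (proj₁ (0-sym bb′))) ⟩
      0ℝ + (dist a′ b′ + 0ℝ)                  ≈⟨ +-comm _ _ ⟩
      dist a′ b′ + 0ℝ + 0ℝ                    ≈⟨ +-identityʳ _ ⟩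
      dist a′ b′ + 0ℝ                         ≈⟨ +-identityʳ _ ⟩
      dist a′ b′                              ∎
      where open ≤-Reasoning

    _≐_ : Rel Domain _
    a ≐ b = Lift ℓ (dist a b ≈ 0ℝ)

    isMetric : IsGeneralMetric _≐_ _≈_ _≤_ 0ℝ _+_ dist
    isMetric = record
      { isSemiMetric = record
        { isQuasiSemiMetric = record
          { isPreMetric = record
            { isProtoMetric = record
              { isPartialOrder  = ≤-isPartialOrder
              ; ≈-isEquivalence = record
                { refl  = lift (≈0 (dist-≤-ev (always F λ i →
                            proj₁ (Met.≈⇒0 i (Met.EqC.refl i)))))
                ; sym   = λ (lift ab) → lift (0-sym ab)
                ; trans = λ (lift ab) (lift bc) → lift (0-trans ab bc)
                }
              ; cong            = λ (lift aa′) (lift bb′) → cong-≤ aa′ bb′ , cong-≤ (0-sym aa′) (0-sym bb′)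
              ; nonNegative     = 0≤dist
              }
            ; ≈⇒0 = Level.lower
            }
          ; 0⇒≈ = lift
          }
        ; sym = λ a b → dist-sym-≤ a b , dist-sym-≤ b a
        }
      ; triangle = triangle
      }

    -- N picks a subsequence sub with dist (sub j) (sub l) < halves j for j ≤ l.
    -- In each coordinate, follow sub for as long as these inequalities hold there;
    -- the coordinatewise limits form a limit of the whole sequence.
    module Limit (s : ℕ → Domain) (cauchy : Cauchy dist s) where

      N : ℕ → ℕ
      N zero    = proj₁ (cauchy (halves zero))
      N (suc k) = N k ℕ.⊔ proj₁ (cauchy (halves (suc k)))

      N-mono : ∀ {j l} → j ℕ.≤ l → N j ℕ.≤ N l
      N-mono {j} {l} j≤l with ℕ.m≤n⇒m<n∨m≡n j≤l
      ... | inj₂ refl              = ℕ.≤-refl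
      ... | inj₁ (ℕ.s≤s j≤l-1) = ℕ.≤-trans (N-mono j≤l-1) (ℕ.m≤m⊔n _ _)

      N-bound : ∀ k → proj₁ (cauchy (halves k)) ℕ.≤ N k
      N-bound zero    = ℕ.≤-refl
      N-bound (suc k) = ℕ.m≤n⊔m (N k) _

      s-close : ∀ k {m n} → N k ℕ.≤ m → N k ℕ.≤ n → dist (s m) (s n) < proj₁ (halves k)
      s-close k Nk≤m Nk≤n = proj₂ (cauchy (halves k)) _ _
        (ℕ.≤-trans (N-bound k) Nk≤m) (ℕ.≤-trans (N-bound k) Nk≤n)

      sub : ℕ → Domain
      sub k = s (N k)

      Good : ℕ → I → Set
      Good k i = ∀ j → j ℕ.< suc k → ∀ l → l ℕ.< suc k → j ℕ.≤ l → M.dist i (sub j i) (sub l i) < proj₁ (halves j)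

      good-ev : ∀ k → Eventually F (Good k)
      good-ev k = all< F (λ j → all< F (λ l → pair j l) (suc k)) (suc k)
        where
        pair : ∀ j l → Eventually F (λ i → j ℕ.≤ l → M.dist i (sub j i) (sub l i) < proj₁ (halves j))
        pair j l with j ℕ.≤? l
        ... | yes j≤l = map₁ F (λ h _ → h) (dist-<-ev (s-close j ℕ.≤-refl (N-mono j≤l)))
        ... | no  j≰l = always F λ i j≤l → ⊥-elim (j≰l j≤l)

      module Coordinate (i : I) where

        self : ∀ a k → M.dist i a a < proj₁ (halves k)
        self a k = ≤-<-trans (proj₁ (Met.≈⇒0 i (Met.EqC.refl i))) (proj₂ (halves k))

        good-mono : ∀ {j k} → j ℕ.≤ k → Good k i → Good j i
        good-mono j≤k g p p< q q< = g p (ℕ.≤-trans p< (ℕ.s≤s j≤k)) q (ℕ.≤-trans q< (ℕ.s≤s j≤k))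

        last : ℕ → ℕ
        last zero    = zero
        last (suc k) = if does (lem {P = Good (suc k) i}) then suc k else last k

        good-last : ∀ k → Good (last k) i
        good-last zero zero _ zero _ _ = self _ zero
        good-last zero (suc _) (ℕ.s≤s ()) _ _ _
        good-last zero zero _ (suc _) (ℕ.s≤s ()) _
        good-last (suc k) with lem {P = Good (suc k) i}
        ... | yes g = g
        ... | no  _ = good-last k

        last-good : ∀ {k} → Good k i → last k ≡ k
        last-good {zero}  _ = refl
        last-good {suc k} g with lem {P = Good (suc k) i}
        ... | yes _  = refl
        ... | no  ¬g = ⊥-elim (¬g g)

        last-const : ∀ {j} l → j ℕ.≤ l → last l ℕ.< j → last l ≡ last j
        last-const {j} l j≤l last< with ℕ.m≤n⇒m<n∨m≡n j≤l
        ... | inj₂ refl = refl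
        last-const {j} (suc l) j≤l last< | inj₁ (ℕ.s≤s j≤l-1) with lem {P = Good (suc l) i}
        ... | yes _ = ⊥-elim (ℕ.<⇒≱ last< j≤l)
        ... | no  _ = last-const l j≤l-1 last<

        track : ℕ → M.Domain i
        track k = sub (last k) i

        track-close : ∀ j l → j ℕ.≤ l → M.dist i (track j) (track l) < proj₁ (halves j)
        track-close j l j≤l with j ℕ.≤? last l
        ... | yes j≤last = subst (λ k → M.dist i (sub k i) (track l) < proj₁ (halves j))
                (≡.sym (last-good (good-mono j≤last (good-last l))))
                (good-last l j (ℕ.s≤s j≤last) (last l) ℕ.≤-refl j≤last)
        ... | no  j≰last = subst (λ k → M.dist i (track j) (sub k i) < proj₁ (halves j))
                (≡.sym (last-const l j≤l (ℕ.≰⇒> j≰last))) (self (track j) j)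

        track-cauchy : Cauchy (M.dist i) track
        track-cauchy η = let k , small = halves-null (half η) in k , λ m n k≤m k≤n →
          ≤-<-trans (≤-trans (Met.triangle i _ (track k) _) (+-mono-≤ (proj₁ (Met.sym i _ _)) ≤-refl))
            (<-≤-trans (+-mono-< (<-trans (track-close k m k≤m) small) (<-trans (track-close k n k≤n) small)) (half+half η))

        limit : M.Domain i
        limit = proj₁ (M.complete i track track-cauchy)

        track-limit : ∀ k → M.dist i (track k) limit ≤ proj₁ (halves k)
        track-limit k = ≤-ε λ η →
          let n , close = proj₂ (M.complete i track track-cauchy) η in
          ≤-trans (Met.triangle i _ (track (k ℕ.⊔ n)) _)
            (+-mono-≤ (<⇒≤ (track-close k _ (ℕ.m≤m⊔n k n))) (<⇒≤ (close _ (ℕ.m≤n⊔m k n))))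

        sub-limit : ∀ {k} → Good k i → M.dist i (sub k i) limit ≤ proj₁ (halves k)
        sub-limit {k} g = subst (λ m → M.dist i (sub m i) limit ≤ proj₁ (halves k)) (last-good g) (track-limit k)

      converges : ConvergesTo dist s Coordinate.limit
      converges η = let k , small = halves-null (half η) in N k , λ n Nk≤n →
        ≤-<-trans (triangle _ (sub k) _)
          (<-≤-trans (+-mono-< (<-trans (s-close k Nk≤n ℕ.≤-refl) small)
                               (≤-<-trans (dist-≤-ev (map₁ F (λ {i} → Coordinate.sub-limit i) (good-ev k))) small))
                     (half+half η))

    at : ∀ {k} i → Vec Domain k → Vec (M.Domain i) k
    at i = Vec.map λ a → a i

    close-ev : ∀ {k δ} {as bs : Vec Domain k} → Pointwise (λ a b → dist a b < δ) as bs →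
               Eventually F (λ i → Pointwise (λ a b → M.dist i a b < δ) (at i as) (at i bs))
    close-ev []       = always F λ i → []
    close-ev (h ∷ hs) = map₁ F (uncurry _∷_) (both F (dist-<-ev h) (close-ev hs))

    pred-bounded : ∀ p (as : Vec Domain (predArity p)) → Bounded F (λ i → M.pred i p (at i as))
    pred-bounded p as =
      (- predBound p , λ i → ∣∣≤⇒-≤ (M.pred-≤ i p _)) ,
      (predBound p , λ i → ≤-trans x≤max (M.pred-≤ i p _))

    reducedProduct : Structure L
    reducedProduct = record
      { Domain    = Domain
      ; _≐_       = _≐_
      ; dist      = dist
      ; isMetric  = isMetric
      ; nonempty  = λ i → M.nonempty i
      ; dist-≤    = λ a b → dist-≤-ev (always F λ i → M.dist-≤ i _ _)
      ; complete  = λ s cauchy → Limit.Coordinate.limit s cauchy , Limit.converges s cauchy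
      ; fun       = λ f as i → M.fun i f (at i as)
      ; fun-unif  = λ f ε close → dist-≤-ev (map₁ F (M.fun-unif _ f ε) (close-ev close))
      ; pred      = λ p as → limsup F λ i → M.pred i p (at i as)
      ; pred-≤    = λ p as → -≤⇒∣∣≤
          (≤-limsup F (pred-bounded p as) λ i → ∣∣≤⇒-≤ (M.pred-≤ i p _))
          (limsup-≤ F (pred-bounded p as) (always F λ i → ≤-trans x≤max (M.pred-≤ i p _)))
      ; pred-unif = λ p ε {as} {bs} close →
          let ev = map₁ F (λ h → ∣-∣≤⇒≤ (M.pred-unif _ p ε h)) (close-ev close) in
          ≤⇒∣-∣≤ (limsup-≤-shift F (pred-bounded p as) (pred-bounded p bs) (map₁ F proj₁ ev))
                 (limsup-≤-shift F (pred-bounded p bs) (pred-bounded p as) (map₁ F proj₂ ev))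
      }

  open ReducedProduct using (reducedProduct) public
  open Structure using (Domain)

  -- The tuple of M_F represented by the family of tuples a i.
  class : {L : Signature ℓ} {I : Set ℓ} (F : Filter I) (M : I → Structure L) →
          (∀ i → Vec (Domain (M i)) n) → Vec (Domain (reducedProduct F M)) n
  class F M a = Vec.tabulate λ k i → Vec.lookup (a i) k

  Preserved Copreserved Bipreserved : {L : Signature ℓ} → Formula L n → Set (lsuc ℓ)
  Preserved {ℓ} {n} {L} φ =
    ∀ {I : Set ℓ} (F : Filter I) (M : I → Structure L) (a : ∀ i → Vec (Domain (M i)) n) →
    value (reducedProduct F M) φ (class F M a) ≤ limsup F (λ i → value (M i) φ (a i))
  Copreserved {ℓ} {n} {L} φ =
    ∀ {I : Set ℓ} (F : Filter I) (M : I → Structure L) (a : ∀ i → Vec (Domain (M i)) n) →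
    limsup F (λ i → value (M i) φ (a i)) ≤ value (reducedProduct F M) φ (class F M a)
  Bipreserved φ = Preserved φ × Copreserved φ

  infixr 8 _⟨_⟩
  _⟨_⟩ : Connective 1 → ℝ → ℝ
  C ⟨ x ⟩ = Connective.fun C (x ∷ [])

  Nondecreasing Nonincreasing : Connective 1 → Set₁
  Nondecreasing C = ∀ {x y} → x ≤ y → C ⟨ x ⟩ ≤ C ⟨ y ⟩
  Nonincreasing C = ∀ {x y} → x ≤ y → C ⟨ y ⟩ ≤ C ⟨ x ⟩

  applyᶠ : Connective 1 → Formula L n → Formula L n
  applyᶠ C φ = connᶠ C (φ ∷ [])

  maxᶠ minᶠ : Formula L n → Formula L n → Formula L n
  maxᶠ φ ψ = connᶠ maxᶜ (φ ∷ ψ ∷ [])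
  minᶠ φ ψ = connᶠ minᶜ (φ ∷ ψ ∷ [])

  constᶠ : ℝ → Formula L n
  constᶠ x = connᶠ (constᶜ x) []

  data Palyutin {L : Signature ℓ} : ∀ {n} → Formula L n → Set (lsuc ℓ) where
    distᴾ  : (t u : Term L n) → Palyutin (distᶠ t u)
    predᴾ  : ∀ p (ts : Vec (Term L n) (Signature.predArity L p)) → Palyutin (predᶠ p ts)
    applyᴾ : {φ : Formula L n} (C : Connective 1) → Nondecreasing C →
             Palyutin φ → Palyutin (applyᶠ C φ)
    maxᴾ   : {φ ψ : Formula L n} → Palyutin φ → Palyutin ψ → Palyutin (maxᶠ φ ψ)
    infᴾ   : {φ : Formula L (suc n)} → Palyutin φ → Palyutin (infᶠ φ)
    supᴾ   : {φ : Formula L (suc n)} → Palyutin φ → Palyutin (supᶠ φ)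
    fixᴾ   : {φ ψ : Formula L (suc n)} (D : Connective 1) → Nonincreasing D →
             (Δ : ℝ) → D ⟨ Δ ⟩ ≈ Δ → Palyutin φ → Palyutin ψ →
             Palyutin (maxᶠ (infᶠ φ) (supᶠ (minᶠ (minᶠ (applyᶠ D φ) (constᶠ Δ)) ψ)))

-- By induction on φ, with limsup commuting with each Palyutin construction; almost
-- optimal elements are chosen in every factor.  The one interesting case is (5), where
-- limsup sup_x min(Dφ,Δ,ψ) must be bounded by the value in the reduced product.  If a
-- real r lay strictly in between, then r < Δ.  In the factors where the supremum
-- exceeds r take an element witnessing this; in almost every other factor inf_x φ < r,
-- so take an element with φ < r, for which Dφ ≥ D r ≥ D Δ = Δ > r.  The chosen elements
-- have Dφ ≥ r almost everywhere and ψ > r frequently, so they form an element at which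
-- min(Dφ,Δ,ψ) ≥ r in the reduced product.
module Submission where

open import Defs
open import Axiom.ExcludedMiddle using (ExcludedMiddle)
open import Data.Empty using (⊥-elim)
open import Data.Product using (∃; _×_; _,_; proj₁; proj₂)
import Data.Rational.Properties as ℚ
open import Data.Vec.Base as Vec using (Vec; []; _∷_)
open import Data.Vec.Properties using (lookup∘tabulate)
open import Data.Vec.Relation.Binary.Pointwise.Inductive using ([]; _∷_)
open import Function using (_∘_)
open import Function.Metric.Structures using (IsGeneralMetric)
open import Level using (Level)
open import Relation.Binary.PropositionalEquality using (_≡_; refl; sym; cong; cong₂)
open import Relation.Unary using (_∈_)
open import Relation.Nullary using (yes; no)
open import Relation.Nullary.Decidable using (decidable-stable)
open Filter using (sets)

private
  variable
    ℓ ℓ′ : Level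
    x y z lo hi : ℝ

-- Intermediate reals and two-sided bounds.

<-dense : x < y → ∃ λ z → x < z × z < y
<-dense {y = y} (mk< {q} q∈y q∉x) =
  let r , q<r , r∈y = rounded y q∈y in fromℚ r , mk< q<r q∉x , mk< r∈y (ℚ.<-irrefl refl)

-- Bounds are carried explicitly because `sup` falls back to 0 on unbounded families, so `sup`,
-- `inf` and `limsup` obey their order laws only for bounded ones.
Within : ℝ → ℝ → ℝ → Set
Within lo hi x = lo ≤ x × x ≤ hi

module _ (lem : ∀ {ℓ} → ExcludedMiddle ℓ) where
  open ContinuousLogic lem

  private
    variable
      A : Set ℓ
      u v : A → ℝ

    x-ε<x : (ε : ℝ⁺) → x - proj₁ ε < x
    x-ε<x (_ , 0<ε) = x<z+y⇒x-y<z (x<x+ε 0<ε)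

    x≤z+y⇒x≤y+z : x ≤ z + y → x ≤ y + z
    x≤z+y⇒x≤y+z h = ≤-trans h (proj₁ (+-comm _ _))

  -- Near-optimal elements, and bounds under each construction.

  inf-< : {f : A → ℝ} → A → inf f < x → ∃ λ a → f a < x
  inf-< a inf<x = decidable-stable lem λ none →
    <⇒≱ inf<x (≤-inf _ a λ a → ≮⇒≥ λ fa<x → none (a , fa<x))

  <-sup : {f : A → ℝ} → A → x < sup f → ∃ λ a → x < f a
  <-sup a x<sup = decidable-stable lem λ none →
    <⇒≱ x<sup (sup-≤ _ a λ a → ≮⇒≥ λ x<fa → none (a , x<fa))

  sup-within : {f : A → ℝ} → A → (∀ a → Within lo hi (f a)) → Within lo hi (sup f)
  sup-within a f∈ =
    ≤-trans (proj₁ (f∈ a)) (≤-sup _ (_ , proj₂ ∘ f∈) a) , sup-≤ _ a (proj₂ ∘ f∈)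

  inf-within : {f : A → ℝ} → A → (∀ a → Within lo hi (f a)) → Within lo hi (inf f)
  inf-within a f∈ =
    ≤-inf _ a (proj₁ ∘ f∈) , ≤-trans (inf-≤ _ (_ , proj₁ ∘ f∈) a) (proj₂ (f∈ a))

  nondecreasing-within : ∀ {C} → Nondecreasing C → Within lo hi x → Within (C ⟨ lo ⟩) (C ⟨ hi ⟩) (C ⟨ x ⟩)
  nondecreasing-within C↑ (lo≤x , x≤hi) = C↑ lo≤x , C↑ x≤hi

  max-within : ∀ {lo₁ hi₁ lo₂ hi₂} → Within lo₁ hi₁ x → Within lo₂ hi₂ y → Within (max lo₁ lo₂) (max hi₁ hi₂) (max x y)
  max-within (p , q) (r , s) =
    max-lub (≤-trans p x≤max) (≤-trans r y≤max) , max-lub (≤-trans q x≤max) (≤-trans s y≤max)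

  -- The matrix of clause (5), with x the value of φ and y that of ψ. The bracketing follows `fixᴾ`,
  -- so the value of that subformula unfolds to it.
  guard : Connective 1 → ℝ → ℝ → ℝ → ℝ
  guard D Δ x y = min (min (D ⟨ x ⟩) Δ) y

  guard-glb : ∀ {D Δ} → z ≤ D ⟨ x ⟩ → z ≤ Δ → z ≤ y → z ≤ guard D Δ x y
  guard-glb p q r = min-glb (min-glb p q) r

  guard≤Δ : ∀ {D Δ} → guard D Δ x y ≤ Δ
  guard≤Δ = ≤-trans min≤x min≤y

  guard≤D : ∀ {D Δ} → guard D Δ x y ≤ D ⟨ x ⟩
  guard≤D = ≤-trans min≤x min≤x

  -- Since D reverses the order, the least value occurs at the largest x and the smallest y. The
  -- upper bound Δ is what later forces `r ≤ Δ`.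
  guard-within : ∀ {D Δ lo₁ hi₁ lo₂ hi₂} → Nonincreasing D → Within lo₁ hi₁ x → Within lo₂ hi₂ y →
                 Within (guard D Δ hi₁ lo₂) Δ (guard D Δ x y)
  guard-within {D = D} D↓ (_ , x≤hi) (lo≤y , _) =
    guard-glb {D = D} (≤-trans (guard≤D {D = D}) (D↓ x≤hi)) (guard≤Δ {D = D}) (≤-trans min≤y lo≤y) ,
    guard≤Δ {D = D}

  -- Continuity is sampled only at two points, one on either side of x: for a monotone connective
  -- these control every value beyond or between them.
  near : (C : Connective 1) (x : ℝ) (ε : ℝ⁺) → ∃ λ (δ : ℝ⁺) →
    (C ⟨ x ⟩ ≤ C ⟨ x + proj₁ δ ⟩ + proj₁ ε × C ⟨ x + proj₁ δ ⟩ ≤ C ⟨ x ⟩ + proj₁ ε) ×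
    (C ⟨ x ⟩ ≤ C ⟨ x - proj₁ δ ⟩ + proj₁ ε × C ⟨ x - proj₁ δ ⟩ ≤ C ⟨ x ⟩ + proj₁ ε)
  -- The sample points must lie strictly within the δ given by continuity, hence the halving.
  near C x ε = half δ ,
    close (x<δ+ (<⇒≤ (x<x+ε 0<δ/2))) (≤-<-trans (proj₁ (+-comm _ _)) (+-monoˡ-< (half< δ))) ,
    close (≤-<-trans (x≤z+y⇒x≤y+z (x-y≤z⇒x≤z+y ≤-refl)) (+-monoˡ-< (half< δ))) (x<δ+ (<⇒≤ (x-ε<x (half δ))))
    where
    δ = proj₁ (Connective.continuous C (x ∷ []) ε)
    0<δ/2 = proj₂ (half δ)
    x<δ+ : y ≤ z → y < proj₁ δ + z
    x<δ+ y≤z = ≤-<-trans y≤z (<-≤-trans (x<x+ε (proj₂ δ)) (proj₁ (+-comm _ _)))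
    close : x < proj₁ δ + y → y < proj₁ δ + x →
            C ⟨ x ⟩ ≤ C ⟨ y ⟩ + proj₁ ε × C ⟨ y ⟩ ≤ C ⟨ x ⟩ + proj₁ ε
    close {y = y} h k =
      let p , q = ∣-∣<⇒< (proj₂ (Connective.continuous C (x ∷ []) ε) (y ∷ []) (<⇒∣-∣< h k ∷ [])) in
      x≤z+y⇒x≤y+z (<⇒≤ p) , x≤z+y⇒x≤y+z (<⇒≤ q)

  -- Limits superior along a filter, and monotone connectives.

  module _ {I : Set ℓ} (F : Filter I) where

    limsup-mono : Bounded F u → Bounded F v → (∀ i → u i ≤ v i) → limsup F u ≤ limsup F v
    limsup-mono bu bv u≤v = ≤-ε λ ε →
      limsup-≤ F bu (map₁ F (λ {i} → ≤-trans (u≤v i)) (limsup-ε F bv ε))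

    limsup-cong : Bounded F u → Bounded F v → (∀ i → u i ≡ v i) → limsup F u ≈ limsup F v
    limsup-cong {u} {v} bu bv u≡v =
      limsup-mono bu bv (λ i → reflexive (u≡v i)) , limsup-mono bv bu (λ i → reflexive (sym (u≡v i)))
      where
      reflexive : x ≡ y → x ≤ y
      reflexive refl = ≤-refl

    -- Otherwise u stays at or below x on all of J, and so does its limsup.
    frequently : Bounded F u → x < limsup F u → ∀ {J} → J ∈ sets F → ∃ λ i → J i × x < u i
    frequently bu x<lim {J} J∈F = decidable-stable lem λ none →
      <⇒≱ x<lim (limsup-≤ F bu (J , J∈F , λ {i} i∈J → ≮⇒≥ λ x<ui → none (i , i∈J , x<ui)))

    within-bounded : (∀ i → Within lo hi (u i)) → Bounded F u
    within-bounded u∈ = (_ , proj₁ ∘ u∈) , (_ , proj₂ ∘ u∈)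

    limsup-within : (∀ i → Within lo hi (u i)) → Within lo hi (limsup F u)
    limsup-within u∈ =
      ≤-limsup F (within-bounded u∈) (proj₁ ∘ u∈) ,
      limsup-≤ F (within-bounded u∈) (always F (proj₂ ∘ u∈))

    limsup-max : (∀ i → Within lo hi (u i)) → ∀ {lo′ hi′} → (∀ i → Within lo′ hi′ (v i)) →
                 limsup F (λ i → max (u i) (v i)) ≈ max (limsup F u) (limsup F v)
    limsup-max u∈ v∈ =
      ≤-ε (λ ε → limsup-≤ F b (map₁ F
        (λ (p , q) → max-lub (≤-trans p (+-monoˡ-≤ x≤max)) (≤-trans q (+-monoˡ-≤ y≤max)))
        (both F (limsup-ε F bu ε) (limsup-ε F bv ε)))) ,
      max-lub (limsup-mono bu b λ _ → x≤max) (limsup-mono bv b λ _ → y≤max)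
      where
      bu = within-bounded u∈
      bv = within-bounded v∈
      b  = within-bounded λ i → max-within (u∈ i) (v∈ i)

    -- Eventually u is at most its limsup plus δ, and frequently it exceeds the limsup minus δ.
    -- Applying C keeps both facts, and `near` absorbs δ into ε.
    limsup-nondecreasing : ∀ {C} → Nondecreasing C → (∀ i → Within lo hi (u i)) →
                           limsup F (λ i → C ⟨ u i ⟩) ≈ C ⟨ limsup F u ⟩
    limsup-nondecreasing {u = u} {C} C↑ u∈ =
      ≤-ε (λ ε →
        let δ , (_ , C⟨+δ⟩≤) , _ = near C (limsup F u) ε in
        limsup-≤ F bCu (map₁ F (λ ui≤ → ≤-trans (C↑ ui≤) C⟨+δ⟩≤) (limsup-ε F bu δ))) ,
      ≤-ε λ ε →
        let δ , _ , (≤C⟨-δ⟩ , _) = near C (limsup F u) ε in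
        ≤-trans ≤C⟨-δ⟩ (+-monoˡ-≤ (≤-limsup′ F bCu λ J J∈F →
          let i , i∈J , <ui = frequently bu (x-ε<x δ) J∈F in i , i∈J , C↑ (<⇒≤ <ui)))
      where
      bu  = within-bounded u∈
      bCu = within-bounded λ i → nondecreasing-within {C = C} C↑ (u∈ i)

    -- With `≤-nonincreasing` this says that D turns the limsup of u into the liminf of D applied to
    -- u. Here the eventual upper bound on u becomes an eventual lower bound on D.
    nonincreasing-ε : ∀ {D} → Nonincreasing D → Bounded F u → (ε : ℝ⁺) →
                      Eventually F λ i → D ⟨ limsup F u ⟩ ≤ D ⟨ u i ⟩ + proj₁ ε
    nonincreasing-ε {u = u} {D} D↓ bu ε =
      let δ , (≤D⟨+δ⟩ , _) , _ = near D (limsup F u) ε in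
      map₁ F (λ ui≤ → ≤-trans ≤D⟨+δ⟩ (+-monoˡ-≤ (D↓ ui≤))) (limsup-ε F bu δ)

    -- A bound valid on a filter set also holds at some index there where u is above its limsup
    -- minus δ; at that index D is at most its value at the limsup minus δ.
    ≤-nonincreasing : ∀ {D} → Nonincreasing D → Bounded F u →
                      Eventually F (λ i → x ≤ D ⟨ u i ⟩) → x ≤ D ⟨ limsup F u ⟩
    ≤-nonincreasing {u = u} {D = D} D↓ bu (J , J∈F , J⊆) = ≤-ε λ ε →
      let δ , _ , (_ , D⟨-δ⟩≤) = near D (limsup F u) ε
          i , i∈J , <ui = frequently bu (x-ε<x δ) J∈F in
      ≤-trans (J⊆ i∈J) (≤-trans (D↓ (<⇒≤ <ui)) D⟨-δ⟩≤)

    -- Infima and suprema over the product against those in the factors.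

    module _ {B : I → Set ℓ′} (b₀ : ∀ i → B i)
             (f : ∀ i → B i → ℝ) (f∈ : ∀ i b → Within lo hi (f i b))
             (h : (∀ i → B i) → ℝ) (h≈ : ∀ b → h b ≈ limsup F λ i → f i (b i)) where

      private
        f-bounded : (b : ∀ i → B i) → Bounded F λ i → f i (b i)
        f-bounded b = within-bounded λ i → f∈ i (b i)

        h∈ : ∀ b → Within lo hi (h b)
        h∈ b = let p , q = limsup-within λ i → f∈ i (b i) in
          ≤-trans p (proj₂ (h≈ b)) , ≤-trans (proj₁ (h≈ b)) q

      -- Elements chosen ε-optimally in every factor assemble into one element of the product, which
      -- gives one inequality; any fixed element of the product gives the other.
      limsup-inf : inf h ≈ limsup F λ i → inf (f i)
      limsup-inf =
        ≤-ε (λ ε →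
          let b , fb≤ = near-inf ε in
          ≤-trans (≤-trans (inf-≤ h (lo , proj₁ ∘ h∈) b) (proj₁ (h≈ b)))
            (x≤z+y⇒x≤y+z (limsup-≤-shift F (f-bounded b) bounded (always F fb≤)))) ,
        ≤-inf h b₀ λ b → ≤-trans
          (limsup-mono bounded (f-bounded b) λ i → inf-≤ (f i) (lo , proj₁ ∘ f∈ i) (b i))
          (proj₂ (h≈ b))
        where
        bounded : Bounded F λ i → inf (f i)
        bounded = within-bounded λ i → inf-within {f = f i} (b₀ i) (f∈ i)
        near-inf : (ε : ℝ⁺) → ∃ λ (b : ∀ i → B i) → ∀ i → f i (b i) ≤ proj₁ ε + inf (f i)
        near-inf ε = proj₁ ∘ b , λ i → ≤-trans (<⇒≤ (proj₂ (b i))) (proj₁ (+-comm _ _))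
          where
          b : ∀ i → ∃ λ b → f i b < inf (f i) + proj₁ ε
          b i = inf-< {f = f i} (b₀ i) (x<x+ε (proj₂ ε))

      limsup-sup : sup h ≈ limsup F λ i → sup (f i)
      limsup-sup =
        sup-≤ h b₀ (λ b → ≤-trans (proj₁ (h≈ b))
          (limsup-mono (f-bounded b) bounded λ i → ≤-sup (f i) (hi , proj₂ ∘ f∈ i) (b i))) ,
        ≤-ε λ ε →
          let b , ≤fb = near-sup ε in
          ≤-trans (x≤z+y⇒x≤y+z (limsup-≤-shift F bounded (f-bounded b) (always F ≤fb)))
            (+-monoˡ-≤ (≤-trans (proj₂ (h≈ b)) (≤-sup h (hi , proj₂ ∘ h∈) b)))
        where
        bounded : Bounded F λ i → sup (f i)
        bounded = within-bounded λ i → sup-within {f = f i} (b₀ i) (f∈ i)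
        near-sup : (ε : ℝ⁺) → ∃ λ (b : ∀ i → B i) → ∀ i → sup (f i) ≤ proj₁ ε + f i (b i)
        near-sup ε = proj₁ ∘ b , λ i → ≤-trans (x-y≤z⇒x≤z+y (<⇒≤ (proj₂ (b i)))) (proj₁ (+-comm _ _))
          where
          b : ∀ i → ∃ λ b → sup (f i) - proj₁ ε < f i b
          b i = <-sup {f = f i} (b₀ i) (x-ε<x ε)

      -- The construction of clause (5).

      module _ {lo′ hi′ : ℝ} (g : ∀ i → B i → ℝ) (g∈ : ∀ i b → Within lo′ hi′ (g i b))
               (k : (∀ i → B i) → ℝ) (k≈ : ∀ b → k b ≈ limsup F λ i → g i (b i))
               (D : Connective 1) (D↓ : Nonincreasing D) (Δ : ℝ) (DΔ≈Δ : D ⟨ Δ ⟩ ≈ Δ) where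

        private
          guards : ∀ i → B i → ℝ
          guards i b = guard D Δ (f i b) (g i b)

          G : (∀ i → B i) → ℝ
          G b = guard D Δ (h b) (k b)

          guards∈ : ∀ i b → Within (guard D Δ hi lo′) Δ (guards i b)
          guards∈ i b = guard-within {D = D} D↓ (f∈ i b) (g∈ i b)

          sup∈ : ∀ i → Within (guard D Δ hi lo′) Δ (sup (guards i))
          sup∈ i = sup-within (b₀ i) (guards∈ i)

          g-bounded : (b : ∀ i → B i) → Bounded F λ i → g i (b i)
          g-bounded b = within-bounded λ i → g∈ i (b i)

          -- The coordinates of b itself suffice. The D term is nearly attained eventually and the ψ
          -- term frequently, so every filter set has an index where both happen.
          guard≤ : ∀ b → G b ≤ limsup F λ i → sup (guards i)
          guard≤ b = ≤-ε λ ε → x-y≤z⇒x≤z+y (≤-limsup′ F (within-bounded sup∈) λ J J∈F →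
            let K , K∈F , K⊆ = nonincreasing-ε {D = D} D↓ (f-bounded b) ε
                i , (i∈J , i∈K) , <gi = frequently (g-bounded b) (x-ε<x ε) (Filter.inter F J∈F K∈F) in
            i , i∈J , ≤-trans
              (guard-glb {D = D}
                (≤-trans (+-monoˡ-≤ (≤-trans (guard≤D {D = D}) (D↓ (proj₂ (h≈ b))))) (x≤z+y⇒x-y≤z (K⊆ i∈K)))
                (≤-trans (<⇒≤ (x-ε<x ε)) (guard≤Δ {D = D}))
                (≤-trans (+-monoˡ-≤ (≤-trans min≤y (proj₁ (k≈ b)))) (<⇒≤ <gi)))
              (≤-sup (guards i) (_ , proj₂ ∘ guards∈ i) (b i)))

          witness-between : ∀ {r} → inf h < r → r < limsup F (λ i → sup (guards i)) → ∃ λ b → r ≤ G b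
          witness-between {r} inf<r r<limsup = b ,
            guard-glb {D = D} (≤-trans r≤D (D↓ (proj₁ (h≈ b)))) r≤Δ (≤-trans r≤limsup-g (proj₂ (k≈ b)))
            where
            r≤Δ : r ≤ Δ
            r≤Δ = ≤-trans (<⇒≤ r<limsup) (proj₂ (limsup-within sup∈))

            -- One element must serve both purposes: the first implication is used frequently, the
            -- second almost everywhere. If the first premise holds, its witness settles both, since
            -- `guard` lies below D.
            choice : ∀ i → ∃ λ b → (r < sup (guards i) → r ≤ guards i b) × (inf (f i) < r → r ≤ D ⟨ f i b ⟩)
            choice i with lem {P = r < sup (guards i)}
            ... | yes r<sup =
              let b , r<b = <-sup {f = guards i} (b₀ i) r<sup in
              b , (λ _ → <⇒≤ r<b) , λ _ → ≤-trans (<⇒≤ r<b) (guard≤D {D = D})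
            ... | no r≮sup with lem {P = inf (f i) < r}
            ...   | yes inf<r =
              let b , fb<r = inf-< {f = f i} (b₀ i) inf<r in
              b , (λ r<sup → ⊥-elim (r≮sup r<sup)) ,
              λ _ → ≤-trans r≤Δ (≤-trans (proj₂ DΔ≈Δ) (D↓ (≤-trans (<⇒≤ fb<r) r≤Δ)))
            -- Nothing is demanded in this factor, so any element will do.
            ...   | no inf≮r = b₀ i , (λ r<sup → ⊥-elim (r≮sup r<sup)) , λ inf<r → ⊥-elim (inf≮r inf<r)

            b : ∀ i → B i
            b = proj₁ ∘ choice

            r≤D : r ≤ D ⟨ limsup F (λ i → f i (b i)) ⟩
            r≤D = ≤-nonincreasing {D = D} D↓ (f-bounded b) (map₁ F (λ {i} → proj₂ (proj₂ (choice i)))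
              -- `limsup-inf` turns `inf h < r` into a strict bound on the limsup of the factorwise
              -- infima, hence into an eventual bound.
              (limsup-< F (within-bounded λ i → inf-within {f = f i} (b₀ i) (f∈ i)) (≤-<-trans (proj₂ limsup-inf) inf<r)))

            r≤limsup-g : r ≤ limsup F (λ i → g i (b i))
            r≤limsup-g = ≤-limsup′ F (g-bounded b) λ J J∈F →
              let i , i∈J , r<sup = frequently (within-bounded sup∈) r<limsup J∈F in
              i , i∈J , ≤-trans (proj₁ (proj₂ (choice i)) r<sup) min≤y

          -- The two terms of the maximum act differently: r above `inf h` produces the element b,
          -- and r above `sup G` contradicts `r ≤ G b`.
          limsup-guard : limsup F (λ i → sup (guards i)) ≤ max (inf h) (sup G)
          limsup-guard = ≮⇒≥ λ max<limsup →
            let r , max<r , r<limsup = <-dense max<limsup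
                b , r≤Gb = witness-between (≤-<-trans x≤max max<r) r<limsup in
            <⇒≱ max<r (≤-trans r≤Gb (≤-trans (≤-sup G (Δ , λ _ → guard≤Δ {D = D}) b) y≤max))

        -- `limsup-max` splits the right side. From left to right the terms compare separately; in
        -- the other direction the guarded suprema are bounded only by the whole maximum.
        limsup-fix : max (inf h) (sup λ b → guard D Δ (h b) (k b)) ≈
                     limsup F λ i → max (inf (f i)) (sup λ b → guard D Δ (f i b) (g i b))
        limsup-fix = ≈-trans
          ( max-lub (≤-trans (proj₁ limsup-inf) x≤max) (≤-trans (sup-≤ G b₀ guard≤) y≤max)
          , max-lub (≤-trans (proj₂ limsup-inf) x≤max) limsup-guard )
          (≈-sym (limsup-max (λ i → inf-within {f = f i} (b₀ i) (f∈ i)) sup∈))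

  -- Uniform bounds and the induction on Palyutin formulas.

  module _ {L : Signature ℓ} where
    open Signature L

    -- The bounds are chosen before the structure, so they serve all factors at once and make the
    -- family of values over I bounded.
    palyutin-bounds : ∀ {n} {φ : Formula L n} → Palyutin φ →
                      ∃ λ lo → ∃ λ hi → ∀ (M : Structure L) ρ → Within lo hi (value M φ ρ)
    palyutin-bounds (distᴾ t u) = 0ℝ , diameter , λ M ρ →
      IsGeneralMetric.nonNegative (Structure.isMetric M) , Structure.dist-≤ M _ _
    palyutin-bounds (predᴾ p ts) = - predBound p , predBound p , λ M ρ →
      let ∣p∣≤ = Structure.pred-≤ M p (terms M ts ρ) in ∣∣≤⇒-≤ ∣p∣≤ , ≤-trans x≤max ∣p∣≤
    palyutin-bounds (applyᴾ C C↑ Pφ) =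
      let _ , _ , φ∈ = palyutin-bounds Pφ in
      _ , _ , λ M ρ → nondecreasing-within {C = C} C↑ (φ∈ M ρ)
    palyutin-bounds (maxᴾ Pφ Pψ) =
      let _ , _ , φ∈ = palyutin-bounds Pφ
          _ , _ , ψ∈ = palyutin-bounds Pψ in
      _ , _ , λ M ρ → max-within (φ∈ M ρ) (ψ∈ M ρ)
    palyutin-bounds (infᴾ Pφ) =
      let _ , _ , φ∈ = palyutin-bounds Pφ in
      _ , _ , λ M ρ → inf-within (Structure.nonempty M) λ b → φ∈ M (b ∷ ρ)
    palyutin-bounds (supᴾ Pφ) =
      let _ , _ , φ∈ = palyutin-bounds Pφ in
      _ , _ , λ M ρ → sup-within (Structure.nonempty M) λ b → φ∈ M (b ∷ ρ)
    palyutin-bounds (fixᴾ D D↓ Δ _ Pφ Pψ) =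
      let _ , _ , φ∈ = palyutin-bounds Pφ
          _ , _ , ψ∈ = palyutin-bounds Pψ in
      _ , _ , λ M ρ → max-within
        (inf-within (Structure.nonempty M) λ b → φ∈ M (b ∷ ρ))
        (sup-within (Structure.nonempty M) λ b → guard-within {D = D} D↓ (φ∈ M (b ∷ ρ)) (ψ∈ M (b ∷ ρ)))

    module _ {I : Set ℓ} (F : Filter I) (M : I → Structure L) where
      open ReducedProduct F M using (bounded; pred-bounded; at)
      open Structure using (Domain; nonempty)

      -- The quotient affects only `_≐_`: elements of the reduced product remain families, so terms
      -- can be compared by propositional equality in each coordinate.
      term-coordinate : ∀ {n} (t : Term L n) (a : ∀ i → Vec (Domain (M i)) n) i →
                        term (reducedProduct F M) t (class F M a) i ≡ term (M i) t (a i)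
      terms-coordinate : ∀ {n k} (ts : Vec (Term L n) k) (a : ∀ i → Vec (Domain (M i)) n) i →
                         at i (terms (reducedProduct F M) ts (class F M a)) ≡ terms (M i) ts (a i)
      term-coordinate (var x)    a i = cong (λ b → b i) (lookup∘tabulate (λ k i → Vec.lookup (a i) k) x)
      term-coordinate (app f ts) a i = cong (Structure.fun (M i) f) (terms-coordinate ts a i)
      terms-coordinate []       a i = refl
      terms-coordinate (t ∷ ts) a i = cong₂ _∷_ (term-coordinate t a i) (terms-coordinate ts a i)

      value-bounds : ∀ {n} {φ : Formula L n} (Pφ : Palyutin φ) (a : ∀ i → Vec (Domain (M i)) n) i →
                     Within (proj₁ (palyutin-bounds Pφ)) (proj₁ (proj₂ (palyutin-bounds Pφ))) (value (M i) φ (a i))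
      value-bounds Pφ a i = proj₂ (proj₂ (palyutin-bounds Pφ)) (M i) (a i)

      value-reducedProduct : ∀ {n} {φ : Formula L n} → Palyutin φ → (a : ∀ i → Vec (Domain (M i)) n) →
        value (reducedProduct F M) φ (class F M a) ≈ limsup F λ i → value (M i) φ (a i)
      value-reducedProduct P@(distᴾ t u) a =
        limsup-cong F (bounded {a = term (reducedProduct F M) t (class F M a)}) (within-bounded F (value-bounds P a))
          λ i → cong₂ (Structure.dist (M i)) (term-coordinate t a i) (term-coordinate u a i)
      value-reducedProduct P@(predᴾ p ts) a =
        limsup-cong F (pred-bounded p _) (within-bounded F (value-bounds P a))
          λ i → cong (Structure.pred (M i) p) (terms-coordinate ts a i)
      value-reducedProduct (applyᴾ C C↑ Pφ) a =
        let p , q = value-reducedProduct Pφ a in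
        -- Monotonicity also shows that C respects `≈`.
        ≈-trans (C↑ p , C↑ q) (≈-sym (limsup-nondecreasing F {C = C} C↑ (value-bounds Pφ a)))
      value-reducedProduct (maxᴾ Pφ Pψ) a =
        let p , q = value-reducedProduct Pφ a
            r , s = value-reducedProduct Pψ a in
        ≈-trans
          ( max-lub (≤-trans p x≤max) (≤-trans r y≤max)
          , max-lub (≤-trans q x≤max) (≤-trans s y≤max) )
          (≈-sym (limsup-max F (value-bounds Pφ a) (value-bounds Pψ a)))
      -- An element b of the reduced product is already a family, and `class` of the extended tuples
      -- `b i ∷ a i` computes to `b ∷ class F M a`, so the induction hypothesis applies directly.
      value-reducedProduct (infᴾ {φ = φ} Pφ) a = limsup-inf F (λ i → nonempty (M i))
        (λ i b → value (M i) φ (b ∷ a i)) (λ i b → proj₂ (proj₂ (palyutin-bounds Pφ)) (M i) (b ∷ a i))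
        (λ b → value (reducedProduct F M) φ (b ∷ class F M a)) λ b → value-reducedProduct Pφ λ i → b i ∷ a i
      value-reducedProduct (supᴾ {φ = φ} Pφ) a = limsup-sup F (λ i → nonempty (M i))
        (λ i b → value (M i) φ (b ∷ a i)) (λ i b → proj₂ (proj₂ (palyutin-bounds Pφ)) (M i) (b ∷ a i))
        (λ b → value (reducedProduct F M) φ (b ∷ class F M a)) λ b → value-reducedProduct Pφ λ i → b i ∷ a i
      value-reducedProduct (fixᴾ {φ = φ} {ψ = ψ} D D↓ Δ DΔ≈Δ Pφ Pψ) a = limsup-fix F (λ i → nonempty (M i))
        (λ i b → value (M i) φ (b ∷ a i)) (λ i b → proj₂ (proj₂ (palyutin-bounds Pφ)) (M i) (b ∷ a i))
        (λ b → value (reducedProduct F M) φ (b ∷ class F M a)) (λ b → value-reducedProduct Pφ λ i → b i ∷ a i)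
        (λ i b → value (M i) ψ (b ∷ a i)) (λ i b → proj₂ (proj₂ (palyutin-bounds Pψ)) (M i) (b ∷ a i))
        (λ b → value (reducedProduct F M) ψ (b ∷ class F M a)) (λ b → value-reducedProduct Pψ λ i → b i ∷ a i)
        D D↓ Δ DΔ≈Δ

  palyutin-bipreserved : ∀ {ℓ} (L : Signature ℓ) {n} (φ : Formula L n) → Palyutin φ →
    Bipreserved φ ×
    (∀ {I : Set ℓ} (M : I → Structure L) (F : Filter I) (a : ∀ i → Vec (Structure.Domain (M i)) n) →
      value (reducedProduct F M) φ (class F M a) ≈ limsup F (λ i → value (M i) φ (a i)))
  palyutin-bipreserved L φ Pφ =
    ( (λ F M a → proj₁ (value-reducedProduct F M Pφ a))
    , (λ F M a → proj₂ (value-reducedProduct F M Pφ a)) ) ,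
    λ M F a → value-reducedProduct F M Pφ a

proposition3p3 : (lem : ∀ {ℓ} → ExcludedMiddle ℓ) → let open ContinuousLogic lem in
    ∀ {ℓ} (L : Signature ℓ) {n} (φ : Formula L n) → Palyutin φ →
    Bipreserved φ ×
    (∀ {I : Set ℓ} (M : I → Structure L) (F : Filter I) (a : ∀ i → Vec (Structure.Domain (M i)) n) →
    value (reducedProduct F M) φ (class F M a) ≈ limsup F (λ i → value (M i) φ (a i)))
proposition3p3 = palyutin-bipreserved
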